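{- (a) For non-empty sets $A,B$: every simple minor of an $A$-to-$B$ constraint $(R_0,S_0)$, and every relaxation of $(R_0,S_0)$, is a conjunctive minor of the one-member family $((R_0,S_0))$; and for every non-empty family $(R,S_j)_{j\in J}$ of constraints of the same arity with common antecedent $R$, the constraint $(R,\bigcap_{j\in J}S_j)$ is a conjunctive minor of the family $(R,S_j)_{j\in J}$. (b) There exist non-empty sets $A,B$, a non-empty family $\mathcal G$ of $A$-to-$B$ constraints, and a conjunctive minor of $\mathcal G$ which cannot be obtained from members of $\mathcal G$ by any combination of taking simple minors, relaxations and intersections of consequents (i.e., it does not belong to the smallest set of $A$-to-$B$ constraints containing $\mathcal G$ and closed under these three operations).
   Context: Positive integers are identified with $n=\{0,\dots,n-1\}$; tuples are maps. An $m$-ary $A$-to-$B$ constraint is a pair $(R,S)$ with $R\subseteq A^m$, $S\subseteq B^m$ ($m$ a positive integer). A relaxation of $(R,S)$ is $(R',S')$ of the same arity with $R'\subseteq R$, $S'\supseteq S$. Intersecting consequents: from a non-empty family $(R,S_j)_{j\in J}$ of constraints with common antecedent, form $(R,\bigcap_j S_j)$. Minor formation scheme: a positive integer $m$, a set $V$ disjoint from the natural numbers, and a non-empty family $H=(h_j)_{j\in J}$ of maps $h_j:n_j\to m\cup V$ ($n_j$ positive integers). For $\mathbf a\in C^m$ and $\sigma:V\to C$, $\mathbf a+\sigma:m\cup V\to C$ agrees with $\mathbf a$ on $m$ and with $\sigma$ on $V$. For $R_j\subseteq C^{n_j}$ and $R\subseteq C^m$: $R$ is a restrictive conjunctive minor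 of $(R_j)$ via $H$ if every $\mathbf a\in R$ admits $\sigma:V\to C$ with $(\mathbf a+\sigma)\circ h_j\in R_j$ for all $j$; extensive if every $\mathbf a\in C^m$ admitting such $\sigma$ is in $R$; tight if both. $(R,S)$ is a conjunctive minor of $(R_j,S_j)_{j\in J}$ via $H$ if $R$ is a restrictive conjunctive minor of $(R_j)$ ($C=A$) and $S$ an extensive conjunctive minor of $(S_j)$ ($C=B$) via $H$; it is a conjunctive minor of the family if this holds for some scheme $H$ (with finite $m,n_j$, arbitrary $J,V$). A simple minor of $(R_0,S_0)$ is a constraint $(R,S)$ such that, for some scheme with $J$ a singleton $\{0\}$ and map $h_0$, $R$ and $S$ are tight conjunctive minors of $(R_0)$ and $(S_0)$ respectively via this scheme. -}

module Defs where

open import Data.Nat using (ℕ; NonZero)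
open import Data.Fin using (Fin)
open import Data.Sum using (_⊎_; [_,_])
open import Data.Product using (Σ; _×_)
open import Data.Unit using (⊤; tt)
open import Function using (_∘_)
open import Relation.Unary using (_⊆_)

Relation : Set → ℕ → Set₁
Relation C m = (Fin m → C) → Set

-- a + σ : m ∪ V → C ; the disjoint union m ∪ V is modelled by Fin m ⊎ V
-- (V is disjoint from the naturals).
_+ₜ_ : {C V : Set} {m : ℕ} → (Fin m → C) → (V → C) → (Fin m ⊎ V → C)
a +ₜ σ = [ a , σ ]

-- An m-ary A-to-B constraint (the arity m is an index; positivity of m is
-- required wherever constraints are quantified over).
record Constraint (A B : Set) (m : ℕ) : Set₁ where
  constructor ⟨_,_⟩
  field
    Ant : Relation A m
    Con : Relation B m
open Constraint public

Relaxation : {A B : Set} {m : ℕ} → Constraint A B m → Constraint A B m → Set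
Relaxation c d = (Ant d ⊆ Ant c) × (Con c ⊆ Con d)

module _ {C : Set} {J : Set} {n : J → ℕ} {m : ℕ}
         (V : Set) (h : (j : J) → Fin (n j) → Fin m ⊎ V)
         (Rs : (j : J) → Relation C (n j)) (R : Relation C m) where

  Witnessed : (Fin m → C) → Set
  Witnessed a = Σ (V → C) (λ σ → (j : J) → Rs j ((a +ₜ σ) ∘ h j))

  RestrictiveCM : Set
  RestrictiveCM = (a : Fin m → C) → R a → Witnessed a

  ExtensiveCM : Set
  ExtensiveCM = (a : Fin m → C) → Witnessed a → R a

  TightCM : Set
  TightCM = RestrictiveCM × ExtensiveCM

record Family (A B : Set) : Set₁ where
  field
    Idx    : Set
    j₀     : Idx
    ar     : Idx → ℕ
    ar-pos : (j : Idx) → NonZero (ar j)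
    member : (j : Idx) → Constraint A B (ar j)
open Family public

ConjMinor : {A B : Set} {m : ℕ} → Family A B → Constraint A B m → Set₁
ConjMinor {A} {B} {m} F c =
  Σ Set (λ V →
  Σ ((j : Idx F) → Fin (ar F j) → Fin m ⊎ V) (λ h →
    RestrictiveCM {A} V h (λ j → Ant (member F j)) (Ant c)
  × ExtensiveCM {B} V h (λ j → Con (member F j)) (Con c)))

SimpleMinor : {A B : Set} {m₀ m : ℕ} → Constraint A B m₀ → Constraint A B m → Set₁
SimpleMinor {A} {B} {m₀} {m} c₀ c =
  Σ Set (λ V →
  Σ (Fin m₀ → Fin m ⊎ V) (λ h₀ →
    TightCM {A} {⊤} {λ _ → m₀} V (λ _ → h₀) (λ _ → Ant c₀) (Ant c)
  × TightCM {B} {⊤} {λ _ → m₀} V (λ _ → h₀) (λ _ → Con c₀) (Con c)))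

single : {A B : Set} {m₀ : ℕ} → NonZero m₀ → Constraint A B m₀ → Family A B
single {m₀ = m₀} nz c₀ = record
  { Idx = ⊤ ; j₀ = tt ; ar = λ _ → m₀ ; ar-pos = λ _ → nz ; member = λ _ → c₀ }

commonAnt : {A B : Set} {m : ℕ} → NonZero m → Relation A m →
            (K : Set) → K → (K → Relation B m) → Family A B
commonAnt {m = m} nz R K k₀ S = record
  { Idx = K ; j₀ = k₀ ; ar = λ _ → m ; ar-pos = λ _ → nz ; member = λ k → ⟨ R , S k ⟩ }

⋂ : {B : Set} {m : ℕ} (K : Set) → (K → Relation B m) → Relation B m
⋂ K S b = (k : K) → S k b

data Closure {A B : Set} (G : Family A B) : (m : ℕ) → Constraint A B m → Set₁ where
  mem   : (j : Idx G) → Closure G (ar G j) (member G j)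
  smin  : {m₀ m : ℕ} {c₀ : Constraint A B m₀} {c : Constraint A B m} →
          NonZero m → Closure G m₀ c₀ → SimpleMinor c₀ c → Closure G m c
  relax : {m : ℕ} {c d : Constraint A B m} →
          Closure G m c → Relaxation c d → Closure G m d
  inter : {m : ℕ} → NonZero m → (R : Relation A m) (K : Set) → K →
          (S : K → Relation B m) → ((k : K) → Closure G m ⟨ R , S k ⟩) →
          Closure G m ⟨ R , ⋂ K S ⟩

{-# OPTIONS --safe #-}
-- Part (b).  A conjunctive minor may use infinitely many existential variables,
-- whereas each of the three operations handles finitely many at a time.  The
-- witness is Cantor's theorem.  An element (i , w) of A carries a number i and
-- a sequence w; an element of B carries a sequence y (the intended image of i)
-- and a "label" whose names are numbers k (the intended images of w).  The
-- constraints ask that y k = w i for every name k.  A map τ : A → B satisfying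
-- all of them would make every sequence w equal to i ↦ y_i k for some number k,
-- which the sequence d k = not (y_k k) refutes.  On the other hand any finite
-- partial solution extends to finitely many further elements, and this property
-- gives an invariant of the three operations which the constraint (full , ∅)
-- does not have.
--
-- The extension step has to define a map on all of an arbitrary set V, and the
-- sequences are not decidably equal.  A label therefore stores the sequence
-- itself together with a table of the finitely many sequences of its stage,
-- and a name records a position in that table and a prefix of the sequence.
module Submission where

open import Defs
open import Data.Bool using (Bool; true; false; not)
open import Data.Bool.Properties using (not-¬)
open import Data.Empty using (⊥)
open import Data.Fin using (Fin; zero; suc; toℕ)
open import Data.List using (List; []; _∷_; length; applyUpTo)
open import Data.List.Properties using (length-applyUpTo)
open import Data.Nat using (ℕ; zero; suc; NonZero; _<_; _≤_; _⊔_; s≤s; z<s; _≟_)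
open import Data.Nat.Binary using (ℕᵇ; 2[1+_]; 1+[2_]) renaming (zero to 0ᵇ; toℕ to fromBinary; fromℕ to toBinary)
open import Data.Nat.Binary.Properties using (fromℕ-toℕ)
open import Data.Nat.Properties using (n≤1+n; ≤-trans; <-≤-trans; <-irrefl; m≤m⊔n; m≤n⊔m)
open import Data.Product using (Σ; ∃; _×_; _,_; proj₁; proj₂; uncurry)
open import Data.Sum using (_⊎_; inj₁; inj₂)
open import Data.Unit using (⊤; tt)
open import Function using (_∘_; id)
open import Relation.Binary.PropositionalEquality using (_≡_; _≢_; _≗_; refl; trans; cong; cong-app; subst)
open import Relation.Nullary using (¬_; yes; no; contradiction)

-- The three operations as conjunctive minors.

simpleMinor⇒conjMinor : {A B : Set} {m₀ m : ℕ} (nz₀ : NonZero m₀)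
  {c₀ : Constraint A B m₀} {c : Constraint A B m} →
  SimpleMinor c₀ c → ConjMinor (single nz₀ c₀) c
simpleMinor⇒conjMinor _ (V , h₀ , (restrictive , _) , (_ , extensive)) =
  V , (λ _ → h₀) , restrictive , extensive

relaxation⇒conjMinor : {A B : Set} {m : ℕ} (nz : NonZero m) {c d : Constraint A B m} →
  Relaxation c d → ConjMinor (single nz c) d
relaxation⇒conjMinor _ (ant⊆ , con⊆) =
  ⊥ , (λ _ → inj₁) ,
  (λ _ r → (λ ()) , λ _ → ant⊆ r) ,
  (λ _ (_ , s) → con⊆ (s tt))

⋂-conjMinor : {A B : Set} {m : ℕ} (nz : NonZero m) (R : Relation A m)
  (K : Set) (k₀ : K) (S : K → Relation B m) →
  ConjMinor (commonAnt nz R K k₀ S) ⟨ R , ⋂ K S ⟩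
⋂-conjMinor _ _ _ _ _ =
  ⊥ , (λ _ → inj₁) , (λ _ r → (λ ()) , λ _ → r) , (λ _ (_ , s) → s)

-- Sequences, their prefixes and the coding of names.

Seq : Set
Seq = ℕ → Bool

lookupOr : Bool → List Bool → ℕ → Bool
lookupOr d []       _       = d
lookupOr d (x ∷ _)  zero    = x
lookupOr d (_ ∷ xs) (suc i) = lookupOr d xs i

lookupOr-< : ∀ {d d′} xs {i} → i < length xs → lookupOr d xs i ≡ lookupOr d′ xs i
lookupOr-< (_ ∷ _)  {zero}  _         = refl
lookupOr-< (_ ∷ xs) {suc i} (s≤s i<n) = lookupOr-< xs i<n

-- Past the end of the prefix the default takes over, and it is already `w i`.
lookupOr-applyUpTo : ∀ (w : Seq) n i → lookupOr (w i) (applyUpTo w n) i ≡ w i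
lookupOr-applyUpTo w zero    _       = refl
lookupOr-applyUpTo w (suc _) zero    = refl
lookupOr-applyUpTo w (suc n) (suc i) = lookupOr-applyUpTo (w ∘ suc) n i

padWith : {C : Set} {n : ℕ} → C → (Fin n → C) → ℕ → C
padWith {n = zero}  c _ _       = c
padWith {n = suc _} _ f zero    = f zero
padWith {n = suc _} c f (suc k) = padWith c (f ∘ suc) k

padWith-toℕ : {C : Set} {n : ℕ} (c : C) (f : Fin n → C) (q : Fin n) →
  padWith c f (toℕ q) ≡ f q
padWith-toℕ c f zero    = refl
padWith-toℕ c f (suc q) = padWith-toℕ c (f ∘ suc) q

bounded : {n : ℕ} (f : Fin n → ℕ) → ∃ λ N → ∀ q → f q < N
bounded {zero}  _ = 0 , λ ()
bounded {suc _} f with bounded (f ∘ suc)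
... | N , f< = suc (f zero) ⊔ N , λ where
  zero    → m≤m⊔n (suc (f zero)) N
  (suc q) → ≤-trans (f< q) (m≤n⊔m (suc (f zero)) N)

_[_]≔_ : {C : Set} → (ℕ → C) → ℕ → C → ℕ → C
(f [ n ]≔ c) k with k ≟ n
... | yes _ = c
... | no  _ = f k

[]≔-eq : {C : Set} (f : ℕ → C) (n : ℕ) (c : C) → (f [ n ]≔ c) n ≡ c
[]≔-eq f n c with n ≟ n
... | yes _   = refl
... | no  n≢n = contradiction refl n≢n

[]≔-≢ : {C : Set} (f : ℕ → C) {n k : ℕ} (c : C) → k ≢ n → (f [ n ]≔ c) k ≡ f k
[]≔-≢ f {n} {k} c k≢n with k ≟ n
... | yes k≡n = contradiction k≡n k≢n
... | no  _   = refl

-- Binary numerals are words over two letters; the word 1ᵖ 2 v encodes (p , v).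

encodeBits : List Bool → ℕᵇ
encodeBits []           = 0ᵇ
encodeBits (true  ∷ xs) = 1+[2 encodeBits xs ]
encodeBits (false ∷ xs) = 2[1+ encodeBits xs ]

decodeBits : ℕᵇ → List Bool
decodeBits 0ᵇ         = []
decodeBits 1+[2 x ]   = true  ∷ decodeBits x
decodeBits 2[1+ x ]   = false ∷ decodeBits x

decodeBits-encodeBits : ∀ xs → decodeBits (encodeBits xs) ≡ xs
decodeBits-encodeBits []           = refl
decodeBits-encodeBits (true  ∷ xs) = cong (true ∷_) (decodeBits-encodeBits xs)
decodeBits-encodeBits (false ∷ xs) = cong (false ∷_) (decodeBits-encodeBits xs)

encodeᵇ : ℕ → List Bool → ℕᵇ
encodeᵇ zero    xs = 2[1+ encodeBits xs ]
encodeᵇ (suc p) xs = 1+[2 encodeᵇ p xs ]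

decodeᵇ : ℕᵇ → ℕ × List Bool
decodeᵇ 0ᵇ        = 0 , []
decodeᵇ 2[1+ x ]  = 0 , decodeBits x
decodeᵇ 1+[2 x ]  = let p , xs = decodeᵇ x in suc p , xs

decodeᵇ-encodeᵇ : ∀ p xs → decodeᵇ (encodeᵇ p xs) ≡ (p , xs)
decodeᵇ-encodeᵇ zero    xs = cong (0 ,_) (decodeBits-encodeBits xs)
decodeᵇ-encodeᵇ (suc p) xs = cong (λ (q , ys) → suc q , ys) (decodeᵇ-encodeᵇ p xs)

encode : ℕ → List Bool → ℕ
encode p xs = fromBinary (encodeᵇ p xs)

decode : ℕ → ℕ × List Bool
decode k = decodeᵇ (toBinary k)

decode-encode : ∀ p xs → decode (encode p xs) ≡ (p , xs)
decode-encode p xs =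
  trans (cong decodeᵇ (fromℕ-toℕ (encodeᵇ p xs))) (decodeᵇ-encodeᵇ p xs)

-- The constraints and the diagonal argument.

record Label : Set where
  constructor label
  field
    stage : ℕ
    table : ℕ → Seq
    seq   : Seq

Names : ℕ → Label → Set
Names k (label n L w) = ∃ λ p → L p ≗ w × k ≡ encode p (applyUpTo w n)

𝔸 𝔹 : Set
𝔸 = ℕ × Seq
𝔹 = Seq × Label

bit : 𝔸 → 𝔸 → Bool
bit (i , _) (_ , w) = w i

-- The first factor stops a label without names from satisfying everything vacuously.
Holds : Bool → 𝔹 → 𝔹 → Set
Holds e (y , _) (_ , x) = ∃ (λ k → Names k x) × (∀ k → Names k x → y k ≡ e)

bitConstraint : Bool → Constraint 𝔸 𝔹 2
bitConstraint e =
  ⟨ (λ a → bit (a zero) (a (suc zero)) ≡ e) , (λ b → Holds e (b zero) (b (suc zero))) ⟩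

-- Many indices carry the same constraint, because a minor formation scheme has
-- just one map for each index.
bitFamily : Family 𝔸 𝔹
bitFamily = record
  { Idx    = 𝔸 × 𝔸
  ; j₀     = (0 , λ _ → false) , (0 , λ _ → false)
  ; ar     = λ _ → 2
  ; ar-pos = λ _ → _
  ; member = λ (u , v) → bitConstraint (bit u v)
  }

inconsistent : Constraint 𝔸 𝔹 1
inconsistent = ⟨ (λ _ → ⊤) , (λ _ → ⊥) ⟩

no-solution : (τ : 𝔸 → 𝔹) → ¬ (∀ u v → Holds (bit u v) (τ u) (τ v))
no-solution τ holds = not-¬ refl (proj₂ (holds (u k) v) k named)
  where
  u : ℕ → 𝔸
  u k = k , λ _ → false
  v : 𝔸
  v = 0 , λ k → not (proj₁ (τ (u k)) k)
  -- Names depend only on the label of `τ v`, so one obtained with `u 0` also serves `u k`.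
  k = proj₁ (proj₁ (holds (u 0) v))
  named = proj₂ (proj₁ (holds (u 0) v))

-- Each element of `𝔸` is its own existential variable: `id` solves the antecedents.
inconsistent-conjMinor : ConjMinor bitFamily inconsistent
inconsistent-conjMinor =
  𝔸 , h , (λ _ _ → id , λ _ → refl) , (λ _ (τ , holds) → no-solution τ (λ u v → holds (u , v)))
  where
  h : 𝔸 × 𝔸 → Fin 2 → Fin 1 ⊎ 𝔸
  h (u , _) zero    = inj₂ u
  h (_ , v) (suc _) = inj₂ v

-- Finite partial solutions.

Tables : Set
Tables = ℕ → ℕ → Seq

-- A name created at stage n is n bits long, so its length identifies the table
-- for the later bits, and indices i < n from earlier stages do not need that
-- table, which was not yet known to them.
answer : Tables → ℕ → ℕ → List Bool → Bool
answer T i p xs = lookupOr (T (length xs) p i) xs i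

answer-name : ∀ T n i {p} {w : Seq} → T n p ≗ w → answer T i p (applyUpTo w n) ≡ w i
answer-name T n i {p} {w} Tnp≗w = trans
  (cong (λ d → lookupOr d (applyUpTo w n) i)
    (trans (cong (λ l → T l p i) (length-applyUpTo w n)) (Tnp≗w i)))
  (lookupOr-applyUpTo w n i)

answer-[]≔ : ∀ T {M} L {i} → i < M → ∀ p xs → answer T i p xs ≡ answer (T [ M ]≔ L) i p xs
answer-[]≔ T {M} L {i} i<M p xs with length xs ≟ M
... | yes refl = lookupOr-< xs i<M
... | no  _    = refl

-- `M` bounds the indices and stages in use, so stage `M` is free for the next table.
record Match (T : Tables) (M : ℕ) (a : 𝔸) (b : 𝔹) : Set where
  constructor match
  open Label (proj₂ b)
  field
    index<  : proj₁ a < M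
    answers : ∀ p xs → proj₁ b (encode p xs) ≡ answer T (proj₁ a) p xs
    stage<  : stage < M
    table≡  : T stage ≡ table
    seq≡    : seq ≡ proj₂ a
    listed  : ∃ λ p → table p ≡ seq

Similar : {m : ℕ} → (Fin m → 𝔸) → (Fin m → 𝔹) → Set
Similar a b = ∃ λ T → ∃ λ M → ∀ j → Match T M (a j) (b j)

match⇒holds : ∀ {T M a a′ b b′} → Match T M a b → Match T M a′ b′ → Holds (bit a a′) b b′
match⇒holds {T} {a = i , _} {b′ = _ , label n _ w}
  (match _ answers _ _ _ _) (match _ _ _ refl refl (p , Lp≡w)) =
  (_ , p , cong-app Lp≡w , refl) ,
  λ { _ (p′ , Lp′≗w , refl) → trans (answers p′ (applyUpTo w n)) (answer-name T n i Lp′≗w) }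

match-weaken : ∀ {T M M′ a b} L → M ≤ M′ → Match T M a b → Match (T [ M ]≔ L) M′ a b
match-weaken {T} L M≤M′ (match i<M answers n<M Tn≡L seq≡ listed) = match
  (<-≤-trans i<M M≤M′)
  (λ p xs → trans (answers p xs) (answer-[]≔ T L i<M p xs))
  (<-≤-trans n<M M≤M′)
  (trans ([]≔-≢ T L (λ n≡M → <-irrefl n≡M n<M)) Tn≡L)
  seq≡ listed

image : Tables → ℕ → (ℕ → Seq) → 𝔸 → 𝔹
image T n L (i , w) = uncurry (answer T i) ∘ decode , label n L w

match-image : ∀ T {n M} L {a} → proj₁ a < M → n < M → T n ≡ L → (∃ λ p → L p ≡ proj₂ a) →
  Match T M a (image T n L a)
match-image T L {i , _} i<M n<M Tn≡L listed =
  match i<M (λ p xs → cong (uncurry (answer T i)) (decode-encode p xs)) n<M Tn≡L refl listed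

-- One new stage, tabling the finitely many sequences met by `h`, defines `τ` on all of `V`; matches
-- are claimed only along `h`.
similar-extend : {m m₀ : ℕ} {V : Set} {a : Fin m → 𝔸} {b : Fin m → 𝔹} →
  Similar a b → (σ : V → 𝔸) (h : Fin m₀ → Fin m ⊎ V) →
  ∃ λ (τ : V → 𝔹) → Similar ((a +ₜ σ) ∘ h) ((b +ₜ τ) ∘ h)
similar-extend {a = a} {b} (T , M , matches) σ h = image T′ M L ∘ σ , T′ , M′ , matches′
  where
  c = (a +ₜ σ) ∘ h
  L : ℕ → Seq
  L = padWith (λ _ → false) (proj₂ ∘ c)
  T′ = T [ M ]≔ L
  N = proj₁ (bounded (proj₁ ∘ c))
  M′ = suc M ⊔ N
  matches′ : ∀ q → Match T′ M′ (c q) ((b +ₜ (image T′ M L ∘ σ)) (h q))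
  matches′ q with h q | proj₂ (bounded (proj₁ ∘ c)) q | padWith-toℕ (λ _ → false) (proj₂ ∘ c) q
  ... | inj₁ j | _   | _  = match-weaken L (≤-trans (n≤1+n M) (m≤m⊔n (suc M) N)) (matches j)
  ... | inj₂ v | i<N | eq =
    match-image T′ L (≤-trans i<N (m≤n⊔m (suc M) N)) (m≤m⊔n (suc M) N) ([]≔-eq T M L) (toℕ q , eq)

-- A simple minor has a single map `h`, hence finitely many coordinates, so `similar-extend` can
-- carry its witness `σ` over to `𝔹`.
closure-invariant : ∀ {m c} → Closure bitFamily m c → ∀ {a b} → Ant c a → Similar a b → Con c b
closure-invariant (mem (u , v)) {b = b} r (_ , _ , matches) =
  subst (λ e → Holds e (b zero) (b (suc zero))) r
    (match⇒holds (matches zero) (matches (suc zero)))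
closure-invariant (smin _ cl (_ , h , (restrictive , _) , (_ , extensive))) {a} {b} r a∼b =
  let σ , r₀ = restrictive a r
      τ , c∼ = similar-extend a∼b σ h
  in extensive b (τ , λ _ → closure-invariant cl (r₀ tt) c∼)
closure-invariant (relax cl (ant⊆ , con⊆)) r a∼b = con⊆ (closure-invariant cl (ant⊆ r) a∼b)
closure-invariant (inter _ _ _ _ _ cls) r a∼b k = closure-invariant (cls k) r a∼b

inconsistent∉closure : ¬ Closure bitFamily 1 inconsistent
inconsistent∉closure cl = closure-invariant cl {a = λ _ → 0 , w} tt
  (T , 1 , λ _ → match-image T (T 0) z<s z<s refl (0 , refl))
  where
  w : Seq
  w _ = false
  T : Tables
  T _ _ = w

theorem3 : ((A B : Set) → A → B →
    ((m₀ m : ℕ) (nz₀ : NonZero m₀) → NonZero m →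
    (c₀ : Constraint A B m₀) (c : Constraint A B m) →
    SimpleMinor c₀ c → ConjMinor (single nz₀ c₀) c)
    × ((m : ℕ) (nz : NonZero m) (c d : Constraint A B m) →
    Relaxation c d → ConjMinor (single nz c) d)
    × ((m : ℕ) (nz : NonZero m) (R : Relation A m) (K : Set) (k₀ : K)
    (S : K → Relation B m) →
    ConjMinor (commonAnt nz R K k₀ S) ⟨ R , ⋂ K S ⟩))
    × Σ Set (λ A → Σ Set (λ B → A × B × Σ (Family A B) (λ G →
    Σ ℕ (λ m → NonZero m × Σ (Constraint A B m) (λ c →
    ConjMinor G c × ¬ Closure G m c)))))
theorem3 =
  (λ _ _ _ _ →
    (λ _ _ nz₀ _ c₀ c → simpleMinor⇒conjMinor nz₀ {c₀} {c}) ,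
    (λ _ nz c d → relaxation⇒conjMinor nz {c} {d}) ,
    (λ _ → ⋂-conjMinor)) ,
  𝔸 , 𝔹 , (0 , λ _ → false) , ((λ _ → false) , label 0 (λ _ _ → false) (λ _ → false)) ,
  bitFamily , 1 , _ , inconsistent , inconsistent-conjMinor , inconsistent∉closure
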